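{- Let $r\ge 1$ be an integer and let $T$ be a (finite) tree with $|V(T)|\ge r+1$. Let $v$ be a shedding vertex of $\mathrm{Ind}_r(T)$. Then, for every connected subgraph $C$ of $T$ containing $v$ and satisfying $|V(C)|\le r-1$, the complex $\mathrm{lk}_{\mathrm{Ind}_r(T)}(V(C))$ has a shedding vertex $w$ such that the induced subgraph $T[V(C)\cup\{w\}]$ is connected.
   Context: Graphs are finite and simple. For a graph $G$ and $A\subseteq V(G)$, $G[A]$ denotes the induced subgraph on $A$. A tree is a connected graph in which there is a unique path between every pair of distinct vertices. A connected subgraph of $T$ is identified with its vertex set and the subgraph it induces. For an integer $r\ge 1$, a subset $A\subseteq V(G)$ is $r$-independent if every connected component of $G[A]$ has at most $r$ vertices. The $r$-independence complex $\mathrm{Ind}_r(G)$ is the simplicial complex whose faces are all $r$-independent subsets of $V(G)$. Facets of a simplicial complex are its inclusion-maximal faces. For a face $F$ of a simplicial complex $\Delta$, $\mathrm{lk}_\Delta(F)=\{F'\in\Delta : F\cap F'=\emptyset,\ F\cup F'\in\Delta\}$. For a vertex $w$ of $\Delta$ (i.e. $\{w\}\in\Delta$), $\mathrm{del}_\Delta(w)=\{F\in\Delta: w\notin F\}$. The vertex $w$ is a shedding vertex of $\Delta$ if every facet of $\mathrm{del}_\Delta(w)$ is a facet of $\Delta$; equivalently, for every facet $F$ of $\mathrm{del}_\Delta(w)$, $F\cup\{w\}$ is not a face of $\Delta$. -}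

module Defs where

open import Data.Bool.Base using (true)
open import Data.Fin.Base using (Fin)
open import Data.Fin.Properties using (sequence)
open import Data.Fin.Subset
  using (Subset; _∈_; _∉_; _⊆_; _∩_; _∪_; ⊤; ⊥; ⁅_⁆; ∣_∣; Nonempty)
open import Data.Fin.Subset.Properties
  using (p⊆q⇒∣p∣≤∣q∣; ⊆-antisym; ⊆-min; x∈p∩q⁺; x∈p∩q⁻; x∈p∪q⁺; x∈p∪q⁻)
open import Data.List.Base using (List; head; last)
open import Data.List.Relation.Unary.Linked using (Linked)
open import Data.List.Relation.Unary.Unique.Propositional using (Unique)
open import Data.Maybe.Base using (just)
open import Data.Nat.Base using (ℕ; _≤_)
open import Data.Nat.Properties using (≤-trans; _≤?_)
open import Data.Product using (∃-syntax; ∃!; _×_; _,_)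
import Data.Product as Product
import Data.Sum.Base as Sum
open import Data.Vec.Base using (tabulate)
open import Data.Vec.Properties using (lookup∘tabulate; lookup⇒[]=; []=⇒lookup)
open import Effect.Monad using (RawMonad)
open import Function.Base using (_∘_; id)
open import Function.Bundles using (_⇔_; mk⇔; Equivalence)
open import Level using (0ℓ)
open import Relation.Binary.Construct.Closure.ReflexiveTransitive using (Star; gmap)
open import Relation.Binary.Core using (Rel)
open import Relation.Binary.Definitions using (Decidable; Irreflexive; Symmetric)
open import Relation.Binary.PropositionalEquality
  using (_≡_; _≢_; sym; trans; subst)
open import Relation.Nullary
  using (Dec; yes; ¬_; does; decidable-stable; ¬¬-excluded-middle)
open import Relation.Nullary.Negation using (¬¬-Monad)
open import Relation.Nullary.Decidable using (dec-true)
open import Relation.Unary using (Pred)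

-- A finite simple graph with vertex set Fin n, so |V(G)| = n.
record Graph (n : ℕ) : Set₁ where
  infix 4 _~_ _~?_
  field
    _~_      : Rel (Fin n) 0ℓ
    _~?_     : Decidable _~_
    ~-sym    : Symmetric _~_
    ~-irrefl : Irreflexive _≡_ _~_

module _ {n : ℕ} (G : Graph n) where
  open Graph G

  -- Adjacency in the induced subgraph G[A], whose vertex set is A.
  InducedAdj : Subset n → Rel (Fin n) 0ℓ
  InducedAdj A x y = x ∈ A × y ∈ A × x ~ y

  -- G[A] is connected.  The empty graph does not count as connected.
  InducedConnected : Subset n → Set
  InducedConnected A =
    Nonempty A × (∀ {x y} → x ∈ A → y ∈ A → Star (InducedAdj A) x y)

  -- K is the vertex set of a connected component of G[A]: all vertices reachable
  -- in G[A] from some vertex x of A.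
  IsComponent : Subset n → Subset n → Set
  IsComponent A K =
    ∃[ x ] x ∈ A × (∀ y → y ∈ K ⇔ Star (InducedAdj A) x y)

  IsPath : Fin n → Fin n → List (Fin n) → Set
  IsPath x y p = Linked _~_ p × Unique p × head p ≡ just x × last p ≡ just y

  IsTree : Set
  IsTree = InducedConnected ⊤ × (∀ {x y} → x ≢ y → ∃! _≡_ (IsPath x y))

  Independent : ℕ → Pred (Subset n) 0ℓ
  Independent r A = ∀ K → IsComponent A K → ∣ K ∣ ≤ r

-- The complex without any faces is allowed, so that the link below is defined
-- for every set F; it is the usual link as soon as F is a face.
record SimplicialComplex (n : ℕ) : Set₁ where
  field
    Face        : Pred (Subset n) 0ℓ
    down-closed : ∀ {F F′} → F ⊆ F′ → Face F′ → Face F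

open SimplicialComplex public

module _ {n : ℕ} where

  Facet : SimplicialComplex n → Pred (Subset n) 0ℓ
  Facet Δ F = Face Δ F × (∀ {F′} → Face Δ F′ → F ⊆ F′ → F ≡ F′)

  link : SimplicialComplex n → Subset n → SimplicialComplex n
  link Δ F .Face F′ = Face Δ F′ × F ∩ F′ ≡ ⊥ × Face Δ (F ∪ F′)
  link Δ F .down-closed {A} {B} A⊆B (fB , F∩B≡⊥ , fF∪B) =
      down-closed Δ A⊆B fB
    , ⊆-antisym
        (λ x∈ → subst (_ ∈_) F∩B≡⊥
                  (x∈p∩q⁺ (Product.map₂ A⊆B (x∈p∩q⁻ F A x∈))))
        (⊆-min _)
    , down-closed Δ (λ x∈ → x∈p∪q⁺ (Sum.map₂ A⊆B (x∈p∪q⁻ F A x∈))) fF∪B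

  deletion : SimplicialComplex n → Fin n → SimplicialComplex n
  deletion Δ w .Face F = Face Δ F × w ∉ F
  deletion Δ w .down-closed A⊆B (fB , w∉B) = down-closed Δ A⊆B fB , w∉B ∘ A⊆B

  IsVertex : SimplicialComplex n → Fin n → Set
  IsVertex Δ w = Face Δ ⁅ w ⁆

  IsShedding : SimplicialComplex n → Fin n → Set
  IsShedding Δ w = IsVertex Δ w × (∀ F → Facet (deletion Δ w) F → Facet Δ F)

private
  fromDec : ∀ {n} {P : Pred (Fin n) 0ℓ} → (∀ x → Dec (P x)) →
            ∃[ K ] (∀ x → x ∈ K ⇔ P x)
  fromDec {P = P} P? = tabulate (does ∘ P?) , λ x → mk⇔
    (λ x∈ → to x (trans (sym (lookup∘tabulate _ x)) ([]=⇒lookup x∈)))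
    (λ px → lookup⇒[]= x _ (trans (lookup∘tabulate _ x) (dec-true (P? x) px)))
    where
    to : ∀ x → does (P? x) ≡ true → P x
    to x eq with P? x
    ... | yes px = px

  ¬¬-subset : ∀ {n} (P : Pred (Fin n) 0ℓ) → ¬ ¬ (∃[ K ] (∀ x → x ∈ K ⇔ P x))
  ¬¬-subset P = fromDec <$> sequence rawApplicative {P = Dec ∘ P} (λ _ → ¬¬-excluded-middle)
    where open RawMonad ¬¬-Monad

  Independent-⊆ : ∀ {n} (G : Graph n) r {A B} → A ⊆ B →
                  Independent G r B → Independent G r A
  Independent-⊆ G r {A} {B} A⊆B indB K (x , x∈A , K⇔) =
    decidable-stable (∣ K ∣ ≤? r) (bound <$> ¬¬-subset (Star (InducedAdj G B) x))
    where
    open RawMonad ¬¬-Monad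
    bound : ∃[ L ] (∀ y → y ∈ L ⇔ Star (InducedAdj G B) x y) → ∣ K ∣ ≤ r
    bound (L , L⇔) = ≤-trans
      (p⊆q⇒∣p∣≤∣q∣ λ {y} y∈K → Equivalence.from (L⇔ y)
        (gmap id (λ (a , b , e) → A⊆B a , A⊆B b , e) (Equivalence.to (K⇔ y) y∈K)))
      (indB L (x , A⊆B x∈A , L⇔))

Ind : ∀ {n} → ℕ → Graph n → SimplicialComplex n
Ind r G .Face        = Independent G r
Ind r G .down-closed = Independent-⊆ G r

{-# OPTIONS --safe #-}
module Submission where

-- A branch is a component of T - C; since T is a tree, it has exactly one vertex
-- adjacent to C, its root.  A branch is small if it has at most r vertices.
--
-- C together with all small branches (the core) has more than r vertices.  Otherwise
-- choose in each large branch a connected set of r + 1 vertices containing the root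
-- (its spike), and extend the core and all spikes without their roots to a facet M.
-- The spikes prevent the roots of large branches from being added, so the core stays a
-- component, and M - v is a facet of the deletion of v that lies properly in M:
-- v would not be a shedding vertex.
--
-- Hence there are small branches; let w be the root of a largest one, B.  Suppose that
-- F is a facet of the deletion of w in the link and F ∪ {w} ⊆ F′ for a face F′ of the
-- link.  Adding to C ∪ F a vertex of B other than w cannot create a component with more
-- than r vertices, so B ⊆ F′.  Adding a vertex x of another small branch B′ cannot
-- either: the new component lies in B′ ∪ (D ─ B), where D is the component of C in
-- C ∪ F′, and |B′ ∪ (D ─ B)| ≤ |D| ≤ r.  So C ∪ F′ contains the core, which is
-- connected and has more than r vertices, contradicting independence.

open import Defs
open import Data.Fin.Base using (Fin)
open import Data.Fin.Properties using (_≟_; any?; all?)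
open import Data.Fin.Subset
  using (Subset; _∈_; _∉_; _⊆_; _⊃_; _∩_; _∪_; _─_; _-_; ∁; ⊤; ⊥; ⁅_⁆; ∣_∣; inside; outside)
open import Data.Fin.Subset.Induction using (⊃-wellFounded; Acc; acc)
open import Data.Fin.Subset.Properties
open import Data.List.Base using (List; []; _∷_; last; filter; allFin)
import Data.List.Extrema
open import Data.List.Membership.Propositional as List using ()
open import Data.List.Membership.Propositional.Properties using (∈-allFin; ∈-filter⁺)
import Data.List.Membership.DecPropositional
open import Data.List.Relation.Unary.All as All using (All; []; _∷_)
open import Data.List.Relation.Unary.All.Properties using (¬Any⇒All¬; all-filter)
open import Data.List.Relation.Unary.Any using (here; there)
open import Data.List.Relation.Unary.AllPairs using ([]; _∷_)
open import Data.List.Relation.Unary.Linked using (Linked; []; [-]; _∷_)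
open import Data.List.Relation.Unary.Unique.Propositional using (Unique)
open import Data.Maybe.Base using (just)
open import Data.Nat.Base using (ℕ; zero; suc; _+_; _∸_; _≤_; _<_; _≥_; z≤n; s≤s)
open import Data.Nat.Properties
  using (≤-reflexive; ≤-trans; ≤-antisym; m≤n⇒m≤1+n; n≤1+n; +-monoˡ-≤; +-suc; +-comm;
         <⇒≱; ≰⇒>; n≮n; _≤?_; _<?_; ≤-totalOrder; module ≤-Reasoning)
open import Data.Product using (∃-syntax; _×_; _,_; proj₁; proj₂)
open import Data.Sum.Base using (_⊎_; inj₁; inj₂; [_,_]′)
open import Data.Vec.Base using ([]; _∷_; tabulate)
open import Data.Vec.Properties using (lookup∘tabulate; lookup⇒[]=; []=⇒lookup)
open import Function.Base using (_∘_; id)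
open import Function.Bundles using (mk⇔; Equivalence)
open import Level using (0ℓ)
open import Relation.Binary.Construct.Closure.ReflexiveTransitive as Star
  using (Star; ε; _◅_; _◅◅_)
open import Relation.Binary.Core using (Rel)
open import Relation.Binary.Definitions using (Decidable)
open import Relation.Binary.PropositionalEquality
  using (_≡_; _≢_; refl; sym; trans; cong; subst)
open import Relation.Nullary using (Dec; yes; no; ¬_; does; ¬?; contradiction)
open import Relation.Nullary.Decidable using (_×-dec_; _⊎-dec_; dec-true; map′; decidable-stable)
open import Relation.Unary using (Pred) renaming (Decidable to Decidable₁)

-- Finite subsets

∣p∪q∣≤∣p∣+∣q∣ : ∀ {n} (p q : Subset n) → ∣ p ∪ q ∣ ≤ ∣ p ∣ + ∣ q ∣
∣p∪q∣≤∣p∣+∣q∣ []            []            = z≤n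
∣p∪q∣≤∣p∣+∣q∣ (outside ∷ p) (outside ∷ q) = ∣p∪q∣≤∣p∣+∣q∣ p q
∣p∪q∣≤∣p∣+∣q∣ (outside ∷ p) (inside  ∷ q) rewrite +-suc ∣ p ∣ ∣ q ∣ = s≤s (∣p∪q∣≤∣p∣+∣q∣ p q)
∣p∪q∣≤∣p∣+∣q∣ (inside  ∷ p) (outside ∷ q) = s≤s (∣p∪q∣≤∣p∣+∣q∣ p q)
∣p∪q∣≤∣p∣+∣q∣ (inside  ∷ p) (inside  ∷ q) rewrite +-suc ∣ p ∣ ∣ q ∣ =
  s≤s (m≤n⇒m≤1+n (∣p∪q∣≤∣p∣+∣q∣ p q))

∣p∩q∣+∣p─q∣≡∣p∣ : ∀ {n} (p q : Subset n) → ∣ p ∩ q ∣ + ∣ p ─ q ∣ ≡ ∣ p ∣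
∣p∩q∣+∣p─q∣≡∣p∣ []            []            = refl
∣p∩q∣+∣p─q∣≡∣p∣ (outside ∷ p) (outside ∷ q) = ∣p∩q∣+∣p─q∣≡∣p∣ p q
∣p∩q∣+∣p─q∣≡∣p∣ (outside ∷ p) (inside  ∷ q) = ∣p∩q∣+∣p─q∣≡∣p∣ p q
∣p∩q∣+∣p─q∣≡∣p∣ (inside  ∷ p) (outside ∷ q) =
  trans (+-suc ∣ p ∩ q ∣ ∣ p ─ q ∣) (cong suc (∣p∩q∣+∣p─q∣≡∣p∣ p q))
∣p∩q∣+∣p─q∣≡∣p∣ (inside  ∷ p) (inside  ∷ q) = cong suc (∣p∩q∣+∣p─q∣≡∣p∣ p q)

q⊆p⇒∣q∣+∣p─q∣≤∣p∣ : ∀ {n} {p q : Subset n} → q ⊆ p → ∣ q ∣ + ∣ p ─ q ∣ ≤ ∣ p ∣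
q⊆p⇒∣q∣+∣p─q∣≤∣p∣ {p = p} {q} q⊆p = ≤-trans
  (+-monoˡ-≤ ∣ p ─ q ∣ (p⊆q⇒∣p∣≤∣q∣ λ x∈q → x∈p∩q⁺ {p = p} (q⊆p x∈q , x∈q)))
  (≤-reflexive (∣p∩q∣+∣p─q∣≡∣p∣ p q))

∣p∪⁅x⁆∣≤1+∣p∣ : ∀ {n} (p : Subset n) x → ∣ p ∪ ⁅ x ⁆ ∣ ≤ suc ∣ p ∣
∣p∪⁅x⁆∣≤1+∣p∣ p x = ≤-trans (∣p∪q∣≤∣p∣+∣q∣ p ⁅ x ⁆)
  (≤-reflexive (trans (cong (∣ p ∣ +_) (∣⁅x⁆∣≡1 x)) (+-comm ∣ p ∣ 1)))

module _ {n : ℕ} where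

  x∈p∪⁅x⁆ : (p : Subset n) (x : Fin n) → x ∈ p ∪ ⁅ x ⁆
  x∈p∪⁅x⁆ p x = q⊆p∪q p ⁅ x ⁆ (x∈⁅x⁆ x)

  x∈p∪⁅y⁆⁻ : (p : Subset n) {x y : Fin n} → x ∈ p ∪ ⁅ y ⁆ → x ∈ p ⊎ x ≡ y
  x∈p∪⁅y⁆⁻ p {y = y} x∈ with x∈p∪q⁻ p ⁅ y ⁆ x∈
  ... | inj₁ x∈p = inj₁ x∈p
  ... | inj₂ x∈y = inj₂ (x∈⁅y⁆⇒x≡y y x∈y)

  p∪⁅x⁆⊆q : {p q : Subset n} {x : Fin n} → p ⊆ q → x ∈ q → p ∪ ⁅ x ⁆ ⊆ q
  p∪⁅x⁆⊆q {p} p⊆q x∈q y∈ with x∈p∪⁅y⁆⁻ p y∈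
  ... | inj₁ y∈p  = p⊆q y∈p
  ... | inj₂ refl = x∈q

  x∉p⇒∣p∪⁅x⁆∣≡1+∣p∣ : {p : Subset n} {x : Fin n} → x ∉ p → ∣ p ∪ ⁅ x ⁆ ∣ ≡ suc ∣ p ∣
  x∉p⇒∣p∪⁅x⁆∣≡1+∣p∣ {p} {x} x∉p = ≤-antisym (∣p∪⁅x⁆∣≤1+∣p∣ p x)
    (p⊂q⇒∣p∣<∣q∣ (p⊆p∪q ⁅ x ⁆ , x , x∈p∪⁅x⁆ p x , x∉p))

  -- A common element would make a second removal of `q` shrink `p ─ q` strictly, although removal
  -- of `q` is idempotent.
  x∈p─q⇒x∉q : {p q : Subset n} {x : Fin n} → x ∈ p ─ q → x ∉ q
  x∈p─q⇒x∉q {p} {q} {x} x∈p─q x∈q = n≮n ∣ p ─ q ∣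
    (subst (λ s → ∣ s ∣ < ∣ p ─ q ∣) (p─q─q≡p─q p q)
      (p∩q≢∅⇒∣p─q∣<∣p∣ (p ─ q) q (x , x∈p∩q⁺ (x∈p─q , x∈q))))

  x∉p-x : {p : Subset n} {x : Fin n} → x ∉ p - x
  x∉p-x {p} {x} x∈ = x∈p─q⇒x∉q {p} x∈ (x∈⁅x⁆ x)

  p⊈q⇒∃ : {p q : Subset n} → ¬ p ⊆ q → ∃[ x ] x ∈ p × x ∉ q
  p⊈q⇒∃ {p} {q} p⊈q with any? (λ x → (x ∈? p) ×-dec ¬? (x ∈? q))
  ... | yes found = found
  ... | no  none  = contradiction
    (λ {x} x∈p → decidable-stable (x ∈? q) λ x∉q → none (x , x∈p , x∉q)) p⊈q

  module _ {P : Pred (Fin n) 0ℓ} (P? : Decidable₁ P) where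

    select : Subset n
    select = tabulate (does ∘ P?)

    ∈-select⁺ : ∀ {x} → P x → x ∈ select
    ∈-select⁺ {x} px = lookup⇒[]= x _ (trans (lookup∘tabulate _ x) (dec-true (P? x) px))

    ∈-select⁻ : ∀ {x} → x ∈ select → P x
    ∈-select⁻ {x} x∈ with P? x | trans (sym (lookup∘tabulate (does ∘ P?) x)) ([]=⇒lookup x∈)
    ... | yes px | _ = px

  -- Vertices are added one at a time. When none can be added the face is maximal, because a larger
  -- face would, by down-closure, allow a single further vertex.
  extendToFacet : (Δ : SimplicialComplex n) → Decidable₁ (Face Δ) →
                  ∀ {A} → Face Δ A → ∃[ M ] A ⊆ M × Facet Δ M
  extendToFacet Δ face? = go (⊃-wellFounded _)
    where
    go : ∀ {A} → Acc _⊃_ A → Face Δ A → ∃[ M ] A ⊆ M × Facet Δ M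
    go {A} (acc rec) fA with any? (λ x → ¬? (x ∈? A) ×-dec face? (A ∪ ⁅ x ⁆))
    ... | yes (x , x∉A , fA∪x) =
      let M , A∪x⊆M , facet = go (rec (p⊆p∪q ⁅ x ⁆ , x , x∈p∪⁅x⁆ A x , x∉A)) fA∪x
      in M , A∪x⊆M ∘ p⊆p∪q ⁅ x ⁆ , facet
    ... | no none = A , id , fA , λ {F′} fF′ A⊆F′ → ⊆-antisym A⊆F′ λ {x} x∈F′ →
      decidable-stable (x ∈? A) λ x∉A →
        none (x , x∉A , down-closed Δ (p∪⁅x⁆⊆q A⊆F′ x∈F′) fF′)

-- Reachability

star-preserves : ∀ {a ℓ p} {A : Set a} {R : Rel A ℓ} (P : A → Set p) →
                 (∀ {x y} → P x → R x y → P y) → ∀ {x y} → P x → Star R x y → P y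
star-preserves P step px ε        = px
star-preserves P step px (r ◅ rs) = star-preserves P step (step px r) rs

module Reachability {n : ℕ} {R : Rel (Fin n) 0ℓ} (R? : Decidable R) where

  Within : Subset n → Rel (Fin n) 0ℓ
  Within S x y = x ∈ S × y ∈ S × R x y

  Closed : Subset n → Set
  Closed S = ∀ {x y} → x ∈ S → R x y → y ∈ S

  -- The walks stay inside `S` itself, so that a set whose growth is stopped early is already
  -- connected.
  Generates : Fin n → Subset n → Set
  Generates x S = x ∈ S × (∀ {y} → y ∈ S → Star (Within S) x y)

  -- Starting from `x`, one vertex is added per round along an edge leaving the set, until there is
  -- no such edge or `suc k` vertices are reached. The bound `k` serves two purposes: `n` yields all
  -- reachable vertices, and a smaller value yields a connected piece of prescribed size.
  grow : ∀ k x → ∃[ S ] Generates x S × (∣ S ∣ ≡ suc k ⊎ (∣ S ∣ ≤ k × Closed S))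
  grow zero x = ⁅ x ⁆ , (x∈⁅x⁆ x , λ y∈ → subst (Star _ x) (sym (x∈⁅y⁆⇒x≡y x y∈)) ε) , inj₁ (∣⁅x⁆∣≡1 x)
  grow (suc k) x with grow k x
  ... | S , gen , inj₂ (∣S∣≤k , closed) = S , gen , inj₂ (m≤n⇒m≤1+n ∣S∣≤k , closed)
  ... | S , gen , inj₁ ∣S∣≡
    with any? (λ a → any? λ b → (a ∈? S) ×-dec ¬? (b ∈? S) ×-dec R? a b)
  ... | no none = S , gen , inj₂ (≤-reflexive ∣S∣≡ , λ {a} {b} a∈S Rab →
          decidable-stable (b ∈? S) λ b∉S → none (a , b , a∈S , b∉S , Rab))
  ... | yes (a , b , a∈S , b∉S , Rab) =
          S ∪ ⁅ b ⁆ , (S⊆ (proj₁ gen) , stars) , inj₁ (trans (x∉p⇒∣p∪⁅x⁆∣≡1+∣p∣ b∉S) (cong suc ∣S∣≡))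
    where
    S⊆ : S ⊆ S ∪ ⁅ b ⁆
    S⊆ = p⊆p∪q ⁅ b ⁆
    lift : ∀ {y} → y ∈ S → Star (Within (S ∪ ⁅ b ⁆)) x y
    lift y∈S = Star.map (λ (p , q , e) → S⊆ p , S⊆ q , e) (proj₂ gen y∈S)
    stars : ∀ {y} → y ∈ S ∪ ⁅ b ⁆ → Star (Within (S ∪ ⁅ b ⁆)) x y
    stars y∈ with x∈p∪⁅y⁆⁻ S y∈
    ... | inj₁ y∈S  = lift y∈S
    ... | inj₂ refl = lift a∈S ◅◅ Star.return (S⊆ a∈S , x∈p∪⁅x⁆ S b , Rab)

  reach : Fin n → Subset n
  reach x = proj₁ (grow n x)

  x∈reach : ∀ x → x ∈ reach x
  x∈reach x = proj₁ (proj₁ (proj₂ (grow n x)))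

  reach-star : ∀ {x y} → y ∈ reach x → Star (Within (reach x)) x y
  reach-star {x} = proj₂ (proj₁ (proj₂ (grow n x)))

  reach-closed : ∀ {x} → Closed (reach x)
  reach-closed {x} with proj₂ (proj₂ (grow n x))
  ... | inj₂ (_ , closed) = closed
  -- A subset of `Fin n` cannot have `n + 1` elements, so with bound `n` the growth ended at a
  -- closed set.
  ... | inj₁ ∣S∣≡1+n = contradiction (subst (_≤ n) ∣S∣≡1+n (∣p∣≤n (reach x))) (n≮n n)

  star⇒∈reach : ∀ {x y} → Star R x y → y ∈ reach x
  star⇒∈reach {x} = star-preserves (_∈ reach x) reach-closed (x∈reach x)

-- Components and independence

module _ {n : ℕ} (G : Graph n) where
  open Graph G

  inducedAdj? : ∀ A → Decidable (InducedAdj G A)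
  inducedAdj? A x y = (x ∈? A) ×-dec (y ∈? A) ×-dec (x ~? y)

  adj-mono : ∀ {A B} → A ⊆ B → ∀ {x y} → InducedAdj G A x y → InducedAdj G B x y
  adj-mono A⊆B (x∈A , y∈A , x~y) = A⊆B x∈A , A⊆B y∈A , x~y

  star-mono : ∀ {A B} → A ⊆ B → ∀ {x y} → Star (InducedAdj G A) x y → Star (InducedAdj G B) x y
  star-mono A⊆B = Star.map (adj-mono A⊆B)

  star-sym : ∀ {A x y} → Star (InducedAdj G A) x y → Star (InducedAdj G A) y x
  star-sym = Star.reverse λ (x∈A , y∈A , x~y) → y∈A , x∈A , ~-sym x~y

  module _ (A : Subset n) where
    open Reachability (inducedAdj? A)

    -- For x ∉ A this is ⁅ x ⁆.
    component : Fin n → Subset n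
    component = reach

    x∈component : ∀ x → x ∈ component x
    x∈component = x∈reach

    component-connected : ∀ {x y} → y ∈ component x → Star (InducedAdj G (component x)) x y
    component-connected y∈ = Star.map (λ (a , b , _ , _ , e) → a , b , e) (reach-star y∈)

    component-star : ∀ {x y} → y ∈ component x → Star (InducedAdj G A) x y
    component-star y∈ = Star.map (λ (_ , _ , e) → e) (reach-star y∈)

    star⇒∈component : ∀ {x y} → Star (InducedAdj G A) x y → y ∈ component x
    star⇒∈component = star⇒∈reach

    component⊆ : ∀ {x} → x ∈ A → component x ⊆ A
    component⊆ x∈A y∈ = star-preserves (_∈ A) (λ _ → proj₁ ∘ proj₂) x∈A (component-star y∈)

    component⊆-closed : ∀ {S x} → x ∈ S → (∀ {a b} → a ∈ S → b ∈ A → a ~ b → b ∈ S) →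
                        component x ⊆ S
    component⊆-closed {S} x∈S closed y∈ =
      star-preserves (_∈ S) (λ a∈S (_ , b∈A , a~b) → closed a∈S b∈A a~b) x∈S (component-star y∈)

    chunk : ℕ → Fin n → Subset n
    chunk k x = proj₁ (grow k x)

    x∈chunk : ∀ k x → x ∈ chunk k x
    x∈chunk k x = proj₁ (proj₁ (proj₂ (grow k x)))

    chunk-connected : ∀ k {x y} → y ∈ chunk k x → Star (InducedAdj G (chunk k x)) x y
    chunk-connected k {x} y∈ =
      Star.map (λ (a , b , _ , _ , e) → a , b , e) (proj₂ (proj₁ (proj₂ (grow k x))) y∈)

    chunk⊆component : ∀ k {x} → chunk k x ⊆ component x
    chunk⊆component k {x} y∈ =
      star⇒∈component (Star.map (λ (_ , _ , e) → e) (proj₂ (proj₁ (proj₂ (grow k x))) y∈))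

    -- Growth that stopped early would have produced a closed set with at most `k` elements, and a
    -- closed set contains the whole component.
    k<∣component∣⇒∣chunk∣≡1+k : ∀ {k x} → k < ∣ component x ∣ → ∣ chunk k x ∣ ≡ suc k
    k<∣component∣⇒∣chunk∣≡1+k {k} {x} k<∣K∣ with grow k x
    ... | S , _ , inj₁ ∣S∣≡1+k = ∣S∣≡1+k
    ... | S , (x∈S , _) , inj₂ (∣S∣≤k , closed) = contradiction
      (≤-trans (p⊆q⇒∣p∣≤∣q∣ λ y∈ → star-preserves (_∈ S) closed x∈S (component-star y∈)) ∣S∣≤k)
      (<⇒≱ k<∣K∣)

  module _ {r : ℕ} where

    -- `K` lies in the component of `x`. This bounds spikes and the core without showing that they
    -- are components.
    independent⇒∣connected∣≤ : ∀ {A K x} → Independent G r A → x ∈ A →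
      (∀ {y} → y ∈ K → Star (InducedAdj G A) x y) → ∣ K ∣ ≤ r
    independent⇒∣connected∣≤ {A} {x = x} indA x∈A stars = ≤-trans
      (p⊆q⇒∣p∣≤∣q∣ (star⇒∈component A ∘ stars))
      (indA (component A x) (x , x∈A , λ _ → mk⇔ (component-star A) (star⇒∈component A)))

    ∣component∣≤⇒independent : ∀ {A} → (∀ {x} → x ∈ A → ∣ component A x ∣ ≤ r) → Independent G r A
    ∣component∣≤⇒independent {A} bound K (x , x∈A , K⇔) = ≤-trans
      (p⊆q⇒∣p∣≤∣q∣ λ {y} y∈K → star⇒∈component A (Equivalence.to (K⇔ y) y∈K))
      (bound x∈A)

    ∣∣≤⇒independent : ∀ {A} → ∣ A ∣ ≤ r → Independent G r A
    ∣∣≤⇒independent {A} ∣A∣≤r =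
      ∣component∣≤⇒independent λ x∈A → ≤-trans (p⊆q⇒∣p∣≤∣q∣ (component⊆ A x∈A)) ∣A∣≤r

    -- It suffices to measure one computed component per vertex of `A`. Vertices outside `A` are
    -- excluded because their singleton is not a component of the induced subgraph.
    independent? : Decidable₁ (Independent G r)
    independent? A = map′
      (λ h → ∣component∣≤⇒independent λ {x} x∈A → [ (λ x∉A → contradiction x∈A x∉A) , id ]′ (h x))
      (λ indA x → split x indA)
      (all? λ x → ¬? (x ∈? A) ⊎-dec (∣ component A x ∣ ≤? r))
      where
      split : ∀ x → Independent G r A → x ∉ A ⊎ ∣ component A x ∣ ≤ r
      split x indA with x ∈? A
      ... | no x∉A  = inj₁ x∉A
      ... | yes x∈A = inj₂ (independent⇒∣connected∣≤ indA x∈A (component-star A))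

    -- Components of `N` that avoid `v` lie in `A` and are bounded there; a component that contains
    -- `v` lies in `component N v`. So adding a vertex only requires control of its own component.
    independent-add : ∀ {A N v} → Independent G r A → (∀ {y} → y ∈ N → y ≢ v → y ∈ A) →
                      ∣ component N v ∣ ≤ r → Independent G r N
    independent-add {A} {N} {v} indA N-v⊆A ∣Nv∣≤r = ∣component∣≤⇒independent bound
      where
      bound : ∀ {x} → x ∈ N → ∣ component N x ∣ ≤ r
      bound {x} x∈N with v ∈? component N x
      ... | yes v∈ = ≤-trans
        (p⊆q⇒∣p∣≤∣q∣ λ y∈ → star⇒∈component N
          (star-sym (component-star N v∈) ◅◅ component-star N y∈))
        ∣Nv∣≤r
      ... | no v∉ = independent⇒∣connected∣≤ indA (component⊆A (x∈component N x))
                      (star-mono component⊆A ∘ component-connected N)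
        where
        component⊆A : component N x ⊆ A
        component⊆A y∈ = N-v⊆A (component⊆ N x∈N y∈) λ { refl → v∉ y∈ }

-- Paths

  open Data.List.Membership.DecPropositional (_≟_ {n}) using () renaming (_∈?_ to _∈ˡ?_)

  -- This cuts off the part of a path before `x`, which removes the loop when a walk returns to `x`.
  path-suffix : ∀ {A x y p} → x List.∈ p → Linked _~_ p → Unique p → last p ≡ just y →
                All (_∈ A) p → ∃[ q ] IsPath G x y q × All (_∈ A) q
  path-suffix (here refl) l u e a = _ , (l , u , refl , e) , a
  path-suffix {p = _ ∷ _ ∷ _} (there x∈p) (_ ∷ l) (_ ∷ u) e (_ ∷ a) = path-suffix x∈p l u e a

  -- Loops are cut out from the end of the walk backwards. Membership in `A` is carried along so
  -- that paths confined to different sets can be told apart.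
  star⇒path : ∀ {A x y} → x ∈ A → Star (InducedAdj G A) x y →
              ∃[ p ] IsPath G x y p × All (_∈ A) p
  star⇒path x∈A ε = _ , ([-] , [] ∷ [] , refl , refl) , x∈A ∷ []
  star⇒path {x = x} x∈A ((_ , z∈A , x~z) ◅ zs) with star⇒path z∈A zs
  ... | p@(_ ∷ _) , (l , u , refl , e) , a with x ∈ˡ? p
  ...   | yes x∈p = path-suffix x∈p l u e a
  ...   | no  x∉p = x ∷ p , (x~z ∷ l , ¬Any⇒All¬ p x∉p ∷ u , refl , e) , x∈A ∷ a

-- Branches of a tree at a connected vertex set

module Branches {n : ℕ} (T : Graph n) (tree : IsTree T)
                {C : Subset n} (connC : InducedConnected T C) where
  open Graph T

  Root : Pred (Fin n) 0ℓ
  Root w = w ∉ C × ∃[ c ] c ∈ C × c ~ w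

  root? : Decidable₁ Root
  root? w = ¬? (w ∈? C) ×-dec any? λ c → (c ∈? C) ×-dec (c ~? w)

  branch : Fin n → Subset n
  branch = component T (∁ C)

  branch-avoids : ∀ {w y} → Root w → y ∈ branch w → y ∉ C
  branch-avoids (w∉C , _) y∈ = x∈∁p⇒x∉p (component⊆ T (∁ C) (x∉p⇒x∈∁p w∉C) y∈)

  branch-closed : ∀ {w a b} → Root w → a ∈ branch w → b ∉ C → a ~ b → b ∈ branch w
  branch-closed root a∈ b∉C a~b = star⇒∈component T (∁ C) (component-star T (∁ C) a∈ ◅◅
    Star.return (x∉p⇒x∈∁p (branch-avoids root a∈) , x∉p⇒x∈∁p b∉C , a~b))

  -- Otherwise there would be two paths from c′ to w, one inside C ∪ {w}
  -- and one whose second vertex is w′.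
  root-unique : ∀ {w w′} → Root w → Root w′ → Star (InducedAdj T (∁ C)) w w′ → w ≡ w′
  root-unique {w} {w′} (w∉C , c , c∈C , c~w) (w′∉C , c′ , c′∈C , c′~w′) ws =
    via (star⇒path T (p⊆p∪q ⁅ w ⁆ c′∈C)
          (star-mono T (p⊆p∪q ⁅ w ⁆) (proj₂ connC c′∈C c∈C) ◅◅
           Star.return (p⊆p∪q ⁅ w ⁆ c∈C , x∈p∪⁅x⁆ C w , c~w)))
        (star⇒path T (x∉p⇒x∈∁p w′∉C) (star-sym T ws))
    where
    via : ∃[ p ] IsPath T c′ w p × All (_∈ C ∪ ⁅ w ⁆) p →
          ∃[ q ] IsPath T w′ w q × All (_∈ ∁ C) q → w ≡ w′
    via (p , path-p , p⊆C∪w) (q@(_ ∷ _) , (l , u , refl , e) , q⊆∁C)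
      with proj₂ tree {c′} {w} (λ { refl → w∉C c′∈C })
    ... | _ , _ , unique with trans (sym (unique path-p)) (unique {y = c′ ∷ q}
            (c′~w′ ∷ l , All.map (λ z∈∁C → λ { refl → x∈p⇒x∉∁p c′∈C z∈∁C }) q⊆∁C ∷ u , refl , e))
    ... | refl with p⊆C∪w
    ... | _ ∷ w′∈ ∷ _ with x∈p∪⁅y⁆⁻ C w′∈
    ... | inj₁ w′∈C = contradiction w′∈C w′∉C
    ... | inj₂ w′≡w = sym w′≡w

  branch-disjoint : ∀ {w w′ y} → Root w → Root w′ → y ∈ branch w → y ∈ branch w′ → w ≡ w′
  branch-disjoint root root′ y∈ y∈′ = root-unique root root′
    (component-star T (∁ C) y∈ ◅◅ star-sym T (component-star T (∁ C) y∈′))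

  -- The vertex `a` is itself a root, and it lies in the branch of `w`, so `root-unique` applies.
  branch-exit : ∀ {w a c} → Root w → a ∈ branch w → c ∈ C → a ~ c → a ≡ w
  branch-exit {a = a} root a∈ c∈C a~c = sym (root-unique root
    (branch-avoids root a∈ , _ , c∈C , ~-sym a~c) (component-star T (∁ C) a∈))

  connected-add : ∀ {w} → Root w → InducedConnected T (C ∪ ⁅ w ⁆)
  connected-add {w} (_ , c , c∈C , c~w) =
    (w , x∈p∪⁅x⁆ C w) , λ x∈ y∈ → star-sym T (from-c x∈) ◅◅ from-c y∈
    where
    from-c : ∀ {y} → y ∈ C ∪ ⁅ w ⁆ → Star (InducedAdj T (C ∪ ⁅ w ⁆)) c y
    from-c y∈ with x∈p∪⁅y⁆⁻ C y∈
    ... | inj₁ y∈C  = star-mono T (p⊆p∪q ⁅ w ⁆) (proj₂ connC c∈C y∈C)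
    ... | inj₂ refl = Star.return (p⊆p∪q ⁅ w ⁆ c∈C , x∈p∪⁅x⁆ C w , c~w)

  -- Small and large branches, the core and the blocker

  module _ (r : ℕ) where

    Small Large : Pred (Fin n) 0ℓ
    Small w = Root w × ∣ branch w ∣ ≤ r
    Large w = Root w × r < ∣ branch w ∣

    small? : Decidable₁ Small
    small? w = root? w ×-dec (∣ branch w ∣ ≤? r)

    InSmall : Pred (Fin n) 0ℓ
    InSmall y = ∃[ w ] Small w × y ∈ branch w

    core? : Decidable₁ (λ y → y ∈ C ⊎ InSmall y)
    core? y = (y ∈? C) ⊎-dec any? λ w → small? w ×-dec (y ∈? branch w)

    core : Subset n
    core = select core?

    C⊆core : C ⊆ core
    C⊆core = ∈-select⁺ core? ∘ inj₁

    -- A small branch has no neighbours outside itself and `C`, so the edge starts in `C`. Its end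
    -- is then a root, and a small one would belong to the core.
    core-exit : ∀ {a b} → a ∈ core → b ∉ core → a ~ b → Large b
    core-exit {a} {b} a∈ b∉ a~b with ∈-select⁻ core? a∈
    ... | inj₂ (w , small , a∈w) =
      contradiction (∈-select⁺ core? (inj₂ (w , small , branch-closed (proj₁ small) a∈w (b∉ ∘ C⊆core) a~b))) b∉
    ... | inj₁ a∈C = root , ≰⇒> λ ∣b∣≤r →
      b∉ (∈-select⁺ core? (inj₂ (b , (root , ∣b∣≤r) , x∈component T (∁ C) b)))
      where
      root : Root b
      root = b∉ ∘ C⊆core , a , a∈C , a~b

    spike : Fin n → Subset n
    spike = chunk T (∁ C) r

    spike⊆branch : ∀ {w} → spike w ⊆ branch w
    spike⊆branch = chunk⊆component T (∁ C) r

    -- With `w` the set would contain the entire spike, which is connected and has `r + 1` vertices.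
    large∉independent : ∀ {w A} → Large w → (∀ {y} → y ∈ spike w → y ≢ w → y ∈ A) →
                        Independent T r A → w ∉ A
    large∉independent {w} {A} (_ , large) spike-w⊆A indA w∈A = contradiction
      (independent⇒∣connected∣≤ T indA w∈A (star-mono T spike⊆A ∘ chunk-connected T (∁ C) r))
      (<⇒≱ (≤-reflexive (sym (k<∣component∣⇒∣chunk∣≡1+k T (∁ C) large))))
      where
      spike⊆A : spike w ⊆ A
      spike⊆A {y} y∈ with y ≟ w
      ... | yes refl = w∈A
      ... | no  y≢w  = spike-w⊆A y∈ y≢w

    blocker? : Decidable₁ (λ y → y ∈ core ⊎ ∃[ w ] Large w × y ∈ spike w × y ≢ w)
    blocker? y = (y ∈? core) ⊎-dec any? λ w →
      (root? w ×-dec (r <? ∣ branch w ∣)) ×-dec (y ∈? spike w) ×-dec ¬? (y ≟ w)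

    blocker : Subset n
    blocker = select blocker?

    core⊆blocker : core ⊆ blocker
    core⊆blocker = ∈-select⁺ blocker? ∘ inj₁

    large∉core : ∀ {w y} → Large w → y ∈ branch w → y ∉ core
    large∉core (root , large) y∈w y∈ with ∈-select⁻ core? y∈
    ... | inj₁ y∈C = branch-avoids root y∈w y∈C
    ... | inj₂ (w′ , (root′ , ∣w′∣≤r) , y∈w′) with branch-disjoint root root′ y∈w y∈w′
    ... | refl = <⇒≱ large ∣w′∣≤r

    large∉blocker : ∀ {w} → Large w → w ∉ blocker
    large∉blocker {w} large w∈ with ∈-select⁻ blocker? w∈
    ... | inj₁ w∈core = large∉core large (x∈component T (∁ C) w) w∈core
    ... | inj₂ (w′ , large′ , w∈w′ , w≢w′) = w≢w′
      (branch-disjoint (proj₁ large) (proj₁ large′) (x∈component T (∁ C) w) (spike⊆branch w∈w′))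

    -- Without the roots of large branches there is no edge from the core to a spike, nor between
    -- spikes of different branches. Each component therefore lies in the core or in one spike
    -- without its root, which has `r` vertices.
    blocker-independent : ∣ core ∣ ≤ r → Independent T r blocker
    blocker-independent ∣core∣≤r = ∣component∣≤⇒independent T bound
      where
      bound : ∀ {x} → x ∈ blocker → ∣ component T blocker x ∣ ≤ r
      bound {x} x∈ with ∈-select⁻ blocker? x∈
      ... | inj₁ x∈core = ≤-trans
        (p⊆q⇒∣p∣≤∣q∣ (component⊆-closed T blocker x∈core λ {a} {b} a∈ b∈ a~b →
          decidable-stable (b ∈? core) λ b∉ → large∉blocker (core-exit a∈ b∉ a~b) b∈))
        ∣core∣≤r
      ... | inj₂ (w , large , x∈w , x≢w) = ≤-trans
        (p⊆q⇒∣p∣≤∣q∣ (component⊆-closed T blocker (x∈p∧x≢y⇒x∈p-y x∈w x≢w) closed))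
        ∣spike-w∣≤r
        where
        ∣spike-w∣≤r : ∣ spike w - w ∣ ≤ r
        ∣spike-w∣≤r with subst (∣ spike w - w ∣ <_) (k<∣component∣⇒∣chunk∣≡1+k T (∁ C) (proj₂ large))
                               (x∈p⇒∣p-x∣<∣p∣ (x∈chunk T (∁ C) r w))
        ... | s≤s ≤r = ≤r
        closed : ∀ {a b} → a ∈ spike w - w → b ∈ blocker → a ~ b → b ∈ spike w - w
        closed {a} {b} a∈ b∈ a~b with ∈-select⁻ blocker? b∈
        -- Read backwards, the edge leaves the core, so `a` is a root. As it lies in the branch of
        -- `w`, it is `w`, which was removed.
        ... | inj₁ b∈core = contradiction (subst (λ z → a ∈ spike w - z) w≡a a∈) (x∉p-x {p = spike w})
          where
          a∈w : a ∈ branch w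
          a∈w = spike⊆branch (p─q⊆p (spike w) ⁅ w ⁆ a∈)
          w≡a : w ≡ a
          w≡a = branch-disjoint (proj₁ large)
            (proj₁ (core-exit b∈core (large∉core large a∈w) (~-sym a~b))) a∈w (x∈component T (∁ C) a)
        -- An edge between vertices outside `C` stays in one branch, so both spikes are the same.
        ... | inj₂ (w′ , large′ , b∈w′ , b≢w′)
          with branch-disjoint (proj₁ large) (proj₁ large′)
                 (branch-closed (proj₁ large) (spike⊆branch (p─q⊆p (spike w) ⁅ w ⁆ a∈))
                   (branch-avoids (proj₁ large′) (spike⊆branch b∈w′)) a~b)
                 (spike⊆branch b∈w′)
        ... | refl = x∈p∧x≢y⇒x∈p-y b∈w′ b≢w′

    -- Size and connectedness of the core

    module _ {v : Fin n} (v∈C : v ∈ C) where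

      -- Let `F` be a face of the deletion that contains `M - v`. The spikes keep the roots of large
      -- branches out of `F`, so in `F ∪ ⁅ v ⁆` the component of `v` is confined to the core. Hence
      -- `F ∪ ⁅ v ⁆` is a face containing `M`, and it equals `M` by maximality.
      ∣core∣≤r⇒deletion-facet : ∣ core ∣ ≤ r → ∀ {M} → blocker ⊆ M → Facet (Ind r T) M →
                                Facet (deletion (Ind r T) v) (M - v)
      ∣core∣≤r⇒deletion-facet ∣core∣≤r {M} blocker⊆M (indM , maxM) =
        (down-closed (Ind r T) M-v⊆M indM , x∉p-x) , λ {F} (indF , v∉F) M-v⊆F →
          ⊆-antisym M-v⊆F (F⊆M-v indF v∉F M-v⊆F)
        where
        M-v⊆M : M - v ⊆ M
        M-v⊆M = p─q⊆p M ⁅ v ⁆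
        module _ {F} (indF : Independent T r F) (v∉F : v ∉ F) (M-v⊆F : M - v ⊆ F) where
          large∉F : ∀ {w} → Large w → w ∉ F
          -- Removing `v` leaves the spikes intact, since `v` lies in `C` and spikes avoid `C`.
          large∉F large = large∉independent large
            (λ y∈w y≢w → M-v⊆F (x∈p∧x≢y⇒x∈p-y
              (blocker⊆M (∈-select⁺ blocker? (inj₂ (_ , large , y∈w , y≢w))))
              λ { refl → branch-avoids (proj₁ large) (spike⊆branch y∈w) v∈C }))
            indF
          indF∪v : Independent T r (F ∪ ⁅ v ⁆)
          indF∪v = independent-add T indF
            (λ y∈ y≢v → [ id , (λ y≡v → contradiction y≡v y≢v) ]′ (x∈p∪⁅y⁆⁻ F y∈))
            (≤-trans (p⊆q⇒∣p∣≤∣q∣ (component⊆-closed T (F ∪ ⁅ v ⁆) (C⊆core v∈C) closed)) ∣core∣≤r)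
            where
            closed : ∀ {a b} → a ∈ core → b ∈ F ∪ ⁅ v ⁆ → a ~ b → b ∈ core
            closed {b = b} a∈ b∈ a~b with x∈p∪⁅y⁆⁻ F b∈
            ... | inj₁ b∈F  = decidable-stable (b ∈? core) λ b∉ → large∉F (core-exit a∈ b∉ a~b) b∈F
            ... | inj₂ refl = C⊆core v∈C
          M⊆F∪v : M ⊆ F ∪ ⁅ v ⁆
          M⊆F∪v {x} x∈M with x ≟ v
          ... | yes refl = x∈p∪⁅x⁆ F v
          ... | no  x≢v  = p⊆p∪q ⁅ v ⁆ (M-v⊆F (x∈p∧x≢y⇒x∈p-y x∈M x≢v))
          F⊆M-v : F ⊆ M - v
          F⊆M-v x∈F = x∈p∧x≢y⇒x∈p-y (subst (_ ∈_) (sym (maxM indF∪v M⊆F∪v)) (p⊆p∪q ⁅ v ⁆ x∈F))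
            λ { refl → v∉F x∈F }

      -- Otherwise shedding would make `M - v` a facet, hence equal to `M`, although `v` belongs to
      -- the core and so to `M`.
      shedding⇒r<∣core∣ : IsShedding (Ind r T) v → r < ∣ core ∣
      shedding⇒r<∣core∣ (_ , shed) = ≰⇒> λ ∣core∣≤r →
        let M , blocker⊆M , facetM = extendToFacet (Ind r T) (independent? T) (blocker-independent ∣core∣≤r)
            facet = shed (M - v) (∣core∣≤r⇒deletion-facet ∣core∣≤r blocker⊆M facetM)
        in x∉p-x {p = M} (subst (v ∈_) (sym (proj₂ facet (proj₁ facetM) (p─q⊆p M ⁅ v ⁆)))
             (blocker⊆M (core⊆blocker (C⊆core v∈C))))

      -- Every small branch hangs on `C` by its root. The walk is stated in a superset `A` so that
      -- it can be used directly in a face that contains the core.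
      core-star : ∀ {A y} → core ⊆ A → y ∈ core → Star (InducedAdj T A) v y
      core-star core⊆A y∈core with ∈-select⁻ core? y∈core
      ... | inj₁ y∈C = star-mono T (core⊆A ∘ C⊆core) (proj₂ connC v∈C y∈C)
      ... | inj₂ (w , small@((_ , c , c∈C , c~w) , _) , y∈w) =
        star-mono T (core⊆A ∘ C⊆core) (proj₂ connC v∈C c∈C) ◅◅
        (core⊆A (C⊆core c∈C) , core⊆A (w⊆core (x∈component T (∁ C) w)) , c~w) ◅
        star-mono T (core⊆A ∘ w⊆core) (component-connected T (∁ C) y∈w)
        where
        w⊆core : branch w ⊆ core
        w⊆core z∈w = ∈-select⁺ core? (inj₂ (w , small , z∈w))

    -- The root of a largest small branch is a shedding vertex of the link

    largest-small : ∀ {w₀} → Small w₀ →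
      ∃[ w ] Small w × (∀ {w′} → Small w′ → ∣ branch w′ ∣ ≤ ∣ branch w ∣)
    largest-small {w₀} small₀ =
      -- `w₀` is the default value of `argmax`; as it is small, the result is small in every case.
      argmax (∣_∣ ∘ branch) w₀ smalls ,
      argmax-all (∣_∣ ∘ branch) small₀ (all-filter small? (allFin n)) ,
      λ {w′} small′ → All.lookup (f[xs]≤f[argmax] w₀ smalls) (∈-filter⁺ small? (∈-allFin w′) small′)
      where
      open Data.List.Extrema ≤-totalOrder
      smalls : List (Fin n)
      smalls = filter small? (allFin n)

    largest-small-shedding : ∣ C ∣ < r → r < ∣ core ∣ → ∀ {w} → Small w →
      (∀ {w′} → Small w′ → ∣ branch w′ ∣ ≤ ∣ branch w ∣) → IsShedding (link (Ind r T) C) w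
    largest-small-shedding ∣C∣<r r<∣core∣ {w} (root , ∣w∣≤r) largest =
      (down-closed (Ind r T) (q⊆p∪q C ⁅ w ⁆) indC∪w , C∩⁅w⁆≡⊥ , indC∪w) ,
      λ F (((indF , C∩F≡⊥ , indC∪F) , w∉F) , maxF) →
        (indF , C∩F≡⊥ , indC∪F) ,
        λ {F′} faceF′ F⊆F′ → facet C∩F≡⊥ indC∪F w∉F maxF faceF′ F⊆F′ (w ∈? F′)
      where
      w∉C : w ∉ C
      w∉C = proj₁ root

      indC∪w : Independent T r (C ∪ ⁅ w ⁆)
      -- The strict bound on `C` leaves room for exactly the one further vertex `w`.
      indC∪w = ∣∣≤⇒independent T (≤-trans (∣p∪⁅x⁆∣≤1+∣p∣ C w) ∣C∣<r)

      C∩⁅w⁆≡⊥ : C ∩ ⁅ w ⁆ ≡ ⊥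
      C∩⁅w⁆≡⊥ = Empty-unique λ (x , x∈) →
        let x∈C , x∈w = x∈p∩q⁻ C ⁅ w ⁆ x∈ in w∉C (subst (_∈ C) (x∈⁅y⁆⇒x≡y w x∈w) x∈C)

      module _ {F : Subset n} (C∩F≡⊥ : C ∩ F ≡ ⊥) (indC∪F : Independent T r (C ∪ F)) (w∉F : w ∉ F)
               (maxF : ∀ {F′} → Face (deletion (link (Ind r T) C) w) F′ → F ⊆ F′ → F ≡ F′) where

        module _ {x : Fin n} (x∉C : x ∉ C) (x∉F : x ∉ F) (x≢w : x ≢ w) where

          N : Subset n
          N = C ∪ (F ∪ ⁅ x ⁆)

          N⁻ : ∀ {y} → y ∈ N → y ∈ C ∪ F ⊎ y ≡ x
          N⁻ y∈ with x∈p∪q⁻ C (F ∪ ⁅ x ⁆) y∈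
          ... | inj₁ y∈C = inj₁ (p⊆p∪q F y∈C)
          ... | inj₂ y∈F∪x with x∈p∪⁅y⁆⁻ F y∈F∪x
          ... | inj₁ y∈F = inj₁ (q⊆p∪q C F y∈F)
          ... | inj₂ y≡x = inj₂ y≡x

          w∉N : w ∉ N
          w∉N w∈ with N⁻ w∈
          ... | inj₂ w≡x = x≢w (sym w≡x)
          ... | inj₁ w∈C∪F = [ w∉C , w∉F ]′ (x∈p∪q⁻ C F w∈C∪F)

          -- Since `x` differs from `w`, the set `F ∪ ⁅ x ⁆` would otherwise be a face of the
          -- deletion, contrary to the maximality of `F`.
          N-dependent : ¬ Independent T r N
          N-dependent indN = x∉F (subst (x ∈_) (sym F≡F∪x) (x∈p∪⁅x⁆ F x))
            where
            C∩[F∪x]≡⊥ : C ∩ (F ∪ ⁅ x ⁆) ≡ ⊥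
            C∩[F∪x]≡⊥ = Empty-unique λ (y , y∈) →
              let y∈C , y∈F∪x = x∈p∩q⁻ C (F ∪ ⁅ x ⁆) y∈
              in [ (λ y∈F → ∉⊥ (subst (y ∈_) C∩F≡⊥ (x∈p∩q⁺ (y∈C , y∈F)))) , (λ { refl → x∉C y∈C }) ]′
                   (x∈p∪⁅y⁆⁻ F y∈F∪x)
            F≡F∪x : F ≡ F ∪ ⁅ x ⁆
            F≡F∪x = maxF ((down-closed (Ind r T) (q⊆p∪q C (F ∪ ⁅ x ⁆)) indN , C∩[F∪x]≡⊥ , indN) ,
                          w∉N ∘ q⊆p∪q C (F ∪ ⁅ x ⁆))
                         (p⊆p∪q ⁅ x ⁆)

          -- To refute the absence of `x` from `F`, it is enough to enclose the component of `x` in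
          -- `N` in a set of at most `r` vertices that no edge of `N` leaves.
          trapped⇒⊥ : ∀ {S} → x ∈ S → (∀ {a b} → a ∈ S → b ∈ N → a ~ b → b ∈ S) → ¬ ∣ S ∣ ≤ r
          trapped⇒⊥ x∈S closed ∣S∣≤r = N-dependent (independent-add T indC∪F
            (λ y∈N y≢x → [ id , (λ y≡x → contradiction y≡x y≢x) ]′ (N⁻ y∈N))
            (≤-trans (p⊆q⇒∣p∣≤∣q∣ (component⊆-closed T N x∈S closed)) ∣S∣≤r))

          -- The branch meets `C` only through `w`, which is missing from `N`, so `x` is trapped in
          -- `branch w - w`.
          x∉branch : x ∉ branch w
          x∉branch x∈w = trapped⇒⊥ (x∈p∧x≢y⇒x∈p-y x∈w x≢w) closed
            (≤-trans (∣p─q∣≤∣p∣ (branch w) ⁅ w ⁆) ∣w∣≤r)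
            where
            closed : ∀ {a b} → a ∈ branch w - w → b ∈ N → a ~ b → b ∈ branch w - w
            closed {a} {b} a∈ b∈N a~b with b ∈? C
            ... | yes b∈C with branch-exit root (p─q⊆p (branch w) ⁅ w ⁆ a∈) b∈C a~b
            ...   | refl = contradiction a∈ (x∉p-x {p = branch w})
            closed {a} {b} a∈ b∈N a~b | no b∉C =
              x∈p∧x≢y⇒x∈p-y (branch-closed root (p─q⊆p (branch w) ⁅ w ⁆ a∈) b∉C a~b)
                λ { refl → w∉N b∈N }

          -- An exchange: `D` contains all of `branch w`, but in `N` the absence of `w` cuts `C` off
          -- from that branch. The vertices thus lost make up for `branch w′`, because `branch w` is
          -- at least as large.
          x∉small : ∀ {F′ w′} → Independent T r (C ∪ F′) → F ⊆ F′ → branch w ⊆ F′ →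
                    Small w′ → x ∉ branch w′
          x∉small {F′} {w′} indC∪F′ F⊆F′ w⊆F′ small′@(root′ , _) x∈w′ =
            trapped⇒⊥ (p⊆p∪q (D ─ branch w) x∈w′) closed (begin
              ∣ branch w′ ∪ (D ─ branch w) ∣        ≤⟨ ∣p∪q∣≤∣p∣+∣q∣ (branch w′) (D ─ branch w) ⟩
              ∣ branch w′ ∣ + ∣ D ─ branch w ∣      ≤⟨ +-monoˡ-≤ ∣ D ─ branch w ∣ (largest small′) ⟩
              ∣ branch w ∣ + ∣ D ─ branch w ∣       ≤⟨ q⊆p⇒∣q∣+∣p─q∣≤∣p∣ w⊆D ⟩
              ∣ D ∣                                 ≤⟨ independent⇒∣connected∣≤ T indC∪F′ (p⊆p∪q F′ c₀∈C)
                                                        (component-star T (C ∪ F′)) ⟩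
              r                                     ∎)
            where
            open ≤-Reasoning
            c₀ = proj₁ (proj₂ root)
            c₀∈C = proj₁ (proj₂ (proj₂ root))
            c₀~w = proj₂ (proj₂ (proj₂ root))
            D : Subset n
            D = component T (C ∪ F′) c₀
            D-closed : ∀ {a b} → a ∈ D → b ∈ C ∪ F′ → a ~ b → b ∈ D
            D-closed a∈D b∈ a~b = star⇒∈component T (C ∪ F′) (component-star T (C ∪ F′) a∈D ◅◅
              Star.return (component⊆ T (C ∪ F′) (p⊆p∪q F′ c₀∈C) a∈D , b∈ , a~b))
            C⊆D : C ⊆ D
            C⊆D y∈C = star⇒∈component T (C ∪ F′) (star-mono T (p⊆p∪q F′) (proj₂ connC c₀∈C y∈C))
            w⊆D : branch w ⊆ D
            w⊆D y∈w = star⇒∈component T (C ∪ F′)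
              (component-star T (C ∪ F′) (D-closed (C⊆D c₀∈C)
                 (q⊆p∪q C F′ (w⊆F′ (x∈component T (∁ C) w))) c₀~w) ◅◅
               star-mono T (q⊆p∪q C F′ ∘ w⊆F′) (component-connected T (∁ C) y∈w))
            closed : ∀ {a b} → a ∈ branch w′ ∪ (D ─ branch w) → b ∈ N → a ~ b →
                     b ∈ branch w′ ∪ (D ─ branch w)
            closed {a} {b} a∈ b∈N a~b with b ∈? C | x∈p∪q⁻ (branch w′) (D ─ branch w) a∈
            ... | yes b∈C | _ = q⊆p∪q (branch w′) (D ─ branch w)
              (x∈p∧x∉q⇒x∈p─q (C⊆D b∈C) λ b∈w → branch-avoids root b∈w b∈C)
            ... | no b∉C | inj₁ a∈w′ = p⊆p∪q (D ─ branch w) (branch-closed root′ a∈w′ b∉C a~b)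
            ... | no b∉C | inj₂ a∈D─w with N⁻ b∈N
            ...   | inj₂ refl = p⊆p∪q (D ─ branch w) x∈w′
            ...   | inj₁ b∈C∪F = q⊆p∪q (branch w′) (D ─ branch w)
              (x∈p∧x∉q⇒x∈p─q
                (D-closed a∈D ([ p⊆p∪q F′ , q⊆p∪q C F′ ∘ F⊆F′ ]′ (x∈p∪q⁻ C F b∈C∪F)) a~b)
                b∉w)
              where
              a∈D : a ∈ D
              a∈D = p─q⊆p D (branch w) a∈D─w
              -- An edge can enter `branch w` from outside only from `C` to `w`, and `w` is not in
              -- `N`.
              b∉w : b ∉ branch w
              b∉w b∈w with a ∈? C
              ... | yes a∈C = w∉N (subst (_∈ N) (branch-exit root b∈w a∈C (~-sym a~b)) b∈N)
              ... | no  a∉C = x∈p─q⇒x∉q a∈D─w (branch-closed root b∈w a∉C (~-sym a~b))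

        facet : ∀ {F′} → Face (link (Ind r T) C) F′ → F ⊆ F′ → Dec (w ∈ F′) → F ≡ F′
        facet faceF′ F⊆F′ (no w∉F′) = maxF (faceF′ , w∉F′) F⊆F′
        facet {F′} (_ , _ , indC∪F′) F⊆F′ (yes w∈F′) =
          contradiction (independent⇒∣connected∣≤ T indC∪F′ (p⊆p∪q F′ v∈C) (core-star v∈C core⊆C∪F′))
                        (<⇒≱ r<∣core∣)
          where
          -- Any vertex of `C` can start the walks through the core; this one witnesses that `C` is
          -- nonempty.
          v∈C = proj₂ (proj₁ connC)
          w⊆F′ : branch w ⊆ F′
          w⊆F′ {y} y∈w with y ≟ w
          ... | yes refl = w∈F′
          -- By maximality `F` already contains every vertex of the branch except `w`.
          ... | no  y≢w  = F⊆F′ (decidable-stable (y ∈? F) λ y∉F →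
            x∉branch (branch-avoids root y∈w) y∉F y≢w y∈w)
          core⊆C∪F′ : core ⊆ C ∪ F′
          core⊆C∪F′ {y} y∈core with ∈-select⁻ core? y∈core
          ... | inj₁ y∈C = p⊆p∪q F′ y∈C
          ... | inj₂ (w′ , small′ , y∈w′) with y ≟ w
          ... | yes refl = q⊆p∪q C F′ w∈F′
          ... | no  y≢w  = q⊆p∪q C F′ (F⊆F′ (decidable-stable (y ∈? F) λ y∉F →
            x∉small (branch-avoids (proj₁ small′) y∈w′) y∉F y≢w indC∪F′ F⊆F′ w⊆F′ small′ y∈w′))

lemma3p3 : ∀ (r n : ℕ) → r ≥ 1 →
    (T : Graph n) → IsTree T → n ≥ r + 1 →
    (v : Fin n) → IsShedding (Ind r T) v →
    (C : Subset n) → InducedConnected T C → v ∈ C → ∣ C ∣ ≤ r ∸ 1 →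
    ∃[ w ] IsShedding (link (Ind r T) C) w × InducedConnected T (C ∪ ⁅ w ⁆)
lemma3p3 r@(suc _) n _ T tree _ v shedding C connC v∈C ∣C∣≤r-1 =
  -- As `C` has fewer than `r` vertices and the core more than `r`, some core vertex lies outside
  -- `C`. Its small branch starts the search for a largest one.
  let x , x∈core , x∉C = p⊈q⇒∃ core⊈C
      _ , small₀ , _ = [ (λ x∈C → contradiction x∈C x∉C) , id ]′ (∈-select⁻ (core? r) x∈core)
      w , small , largest = largest-small r small₀
  in w , largest-small-shedding r (s≤s ∣C∣≤r-1) r<∣core∣ small largest , connected-add (proj₁ small)
  where
  open Branches T tree connC
  r<∣core∣ : r < ∣ core r ∣
  r<∣core∣ = shedding⇒r<∣core∣ r v∈C shedding
  core⊈C : ¬ core r ⊆ C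
  core⊈C core⊆C = <⇒≱ r<∣core∣ (≤-trans (p⊆q⇒∣p∣≤∣q∣ core⊆C) (≤-trans ∣C∣≤r-1 (n≤1+n _)))
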